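{- For even $n\ge4$, $\rho_{pw}(n)\ge 1-\frac2n-\Theta(1/n^2)$.
   Context: A random graph distribution on $n$ vertices is a probability distribution over graphs on a fixed vertex set of size $n$; $X_e$ is the event that potential edge $e$ is present. Pairwise independence: $X_e,X_f$ are independent whenever $e,f$ share no endpoint. $\mathcal{G}_{pw}(n,p)$ is the class of pairwise independent distributions on $n$ vertices with $\Pr[X_e]\ge p$ for all potential edges $e$, and $\rho_{pw}(n):=\inf\{p\in[0,1]:\forall\mathcal{D}\in\mathcal{G}_{pw}(n,p),\ \Pr_{G\sim\mathcal{D}}[G\text{ connected}]>0\}$.
   Formalization: The threshold p in the infimum defining $\rho_{pw}(n)$ ranges only over rationals in [0,1], and the distributions in $\mathcal{G}_{pw}(n,p)$ take rational probabilities. -}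

module Defs where

open import Data.Nat as ℕ using (ℕ; zero; suc)
open import Data.Integer using (+_)
open import Data.Fin using (Fin; _<_)
open import Data.Bool using (Bool; true; false; _∧_; if_then_else_)
open import Data.Product using (Σ; _×_; _,_; ∃; proj₁; proj₂)
open import Data.List using (List; []; _∷_; foldr)
open import Data.List.Relation.Unary.All using (All)
open import Data.List.Relation.Unary.Any using (Any)
open import Data.Rational using (ℚ; 0ℚ; 1ℚ; _+_; _*_; _≤_; _<_; _/_)
open import Relation.Binary.PropositionalEquality using (_≡_; _≢_)
open import Relation.Nullary using (¬_)

-- Vertex set: Fin n.  A potential edge is an unordered pair {i,j}, i ≠ j,
-- represented canonically as (i , j) with i < j.
Edge : ℕ → Set
Edge n = Σ (Fin n × Fin n) λ ij → proj₁ ij Data.Fin.< proj₂ ij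

Graph : ℕ → Set
Graph n = Edge n → Bool

data Adj {n : ℕ} (g : Graph n) : Fin n → Fin n → Set where
  fwd : ∀ {i j} (p : i Data.Fin.< j) → g ((i , j) , p) ≡ true → Adj g i j
  bwd : ∀ {i j} (p : i Data.Fin.< j) → g ((i , j) , p) ≡ true → Adj g j i

data Reach {n : ℕ} (g : Graph n) : Fin n → Fin n → Set where
  here : ∀ {u} → Reach g u u
  step : ∀ {u v w} → Adj g u v → Reach g v w → Reach g u w

Connected : ∀ {n} → Graph n → Set
Connected {n} g = ∀ (u v : Fin n) → Reach g u v

-- A random graph distribution: finitely supported, rational weights,
-- given as a list of (weight , graph) pairs.
Dist : ℕ → Set
Dist n = List (ℚ × Graph n)

totalWeight : ∀ {n} → Dist n → ℚ
totalWeight = foldr (λ wg acc → proj₁ wg + acc) 0ℚ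

IsDist : ∀ {n} → Dist n → Set
IsDist D = All (λ wg → 0ℚ ≤ proj₁ wg) D × totalWeight D ≡ 1ℚ

Pr : ∀ {n} → Dist n → (Graph n → Bool) → ℚ
Pr D A = foldr (λ wg acc → (if A (proj₂ wg) then proj₁ wg else 0ℚ) + acc) 0ℚ D

X : ∀ {n} → Edge n → Graph n → Bool
X e g = g e

Disjoint : ∀ {n} → Edge n → Edge n → Set
Disjoint ((i , j) , _) ((k , l) , _) = i ≢ k × i ≢ l × j ≢ k × j ≢ l

PairwiseIndependent : ∀ {n} → Dist n → Set
PairwiseIndependent {n} D =
  ∀ (e f : Edge n) → Disjoint e f →
    Pr D (λ g → X e g ∧ X f g) ≡ Pr D (X e) * Pr D (X f)

InGpw : (n : ℕ) → ℚ → Dist n → Set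
InGpw n p D = IsDist D × PairwiseIndependent D × (∀ (e : Edge n) → p ≤ Pr D (X e))

-- Pr_{G∼D}[G connected] > 0  (finite support: some positive-weight connected graph)
PrConnectedPos : ∀ {n} → Dist n → Set
PrConnectedPos D = Any (λ wg → 0ℚ Data.Rational.< proj₁ wg × Connected (proj₂ wg)) D

-- q ≤ ρ_pw(n) = inf { p ∈ [0,1] : ∀ D ∈ G_pw(n,p), Pr[connected] > 0 },
-- i.e. every p ∈ [0,1] in that set satisfies q ≤ p; contrapositively,
-- no p ∈ [0,1] with p < q lies in the set.
RhoPwAtLeast : ℕ → ℚ → Set
RhoPwAtLeast n q =
  ∀ (p : ℚ) → 0ℚ ≤ p → p ≤ 1ℚ → p Data.Rational.< q →
    ¬ (∀ (D : Dist n) → InGpw n p D → PrConnectedPos D)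

-- 1/n as a rational (value at 0 irrelevant; only used for n ≥ 4)
inv : ℕ → ℚ
inv zero = 0ℚ
inv (suc k) = + 1 / suc k

-- One distribution witnesses the bound for every n = 4 + k.  Give each
-- graph K_n − v, the complete graph with the edges at v deleted, probability (n−4)/(n−2)², and the
-- empty graph the remaining 4/(n−2)²; every graph in the support has an isolated vertex.  An edge e
-- is present in K_n − v iff v ∉ e, so Pr[X_e] = (n−2)(n−4)/(n−2)² = (n−4)/(n−2), and for disjoint
-- e, f, Pr[X_e X_f] = (n−4)(n−4)/(n−2)² = Pr[X_e] Pr[X_f].  Finally
-- (n−4)/(n−2) = 1 − 2/n − 8/n² + 4(n−4)/((n−2)n²).
module Submission where

open import Defs
open import Data.Nat using (ℕ; _≤_)
open import Data.Nat.Divisibility using (_∣_)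
open import Data.Product using (∃)
open import Data.Integer using (+_)
open import Data.Rational using (1ℚ; _-_; _*_; _/_)

open import Data.Nat using (zero; suc; z≤n; s≤s)
import Data.Nat as ℕ
import Data.Nat.Properties as ℕ
open import Data.Integer.Solver using () renaming (module +-*-Solver to ℤ-Solver)
open import Data.Fin using (Fin; zero; suc)
open import Data.Fin.Properties using (_≟_; <⇒≢)
open import Data.Bool using (Bool; true; false; not; _∧_; if_then_else_)
open import Data.Bool.Properties using (∧-assoc; ∧-zeroʳ)
open import Data.Product using (_,_; proj₂)
open import Data.List using (List; []; _∷_; [_]; _++_; length; tabulate)
open import Data.List.Membership.Propositional using (_∈_)
open import Data.List.Relation.Unary.All as All using (All; []; _∷_)
open import Data.List.Relation.Unary.All.Properties using (++⁺; tabulate⁺; All¬⇒¬Any)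
open import Data.List.Relation.Unary.Any using (here; there)
open import Data.List.Relation.Unary.AllPairs using ([]; _∷_)
open import Data.List.Relation.Unary.Unique.Propositional using (Unique)
open import Data.Empty using (⊥-elim)
open import Function using (_∘_)
open import Relation.Nullary using (¬_; does)
open import Relation.Nullary.Decidable using (dec-true; dec-false)
open import Relation.Binary.PropositionalEquality
  using (_≡_; _≢_; refl; sym; trans; cong; cong₂; module ≡-Reasoning)
open import Data.Rational as ℚ using (ℚ; 0ℚ; _+_; toℚᵘ)
import Data.Rational.Properties as ℚ
import Data.Rational.Unnormalised as ℚᵘ
import Data.Rational.Unnormalised.Properties as ℚᵘ
open import Data.Rational.Solver using () renaming (module +-*-Solver to ℚ-Solver)

fromℕ : ℕ → ℚ
fromℕ c = + c / 1

-- + c / suc d is definitionally fromℚᵘ (mkℚᵘ (+ c) d), so both identities can be checked in ℚᵘ.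
fromℕ-suc : ∀ c → fromℕ (suc c) ≡ 1ℚ + fromℕ c
fromℕ-suc c = ℚ.toℚᵘ-injective (begin
  toℚᵘ (fromℕ (suc c))             ≈⟨ ℚ.toℚᵘ-fromℚᵘ (ℚᵘ.mkℚᵘ (+ suc c) 0) ⟩
  ℚᵘ.mkℚᵘ (+ suc c) 0              ≈⟨ ℚᵘ.*≡* (solve 1 (λ x → (con (+ 1) :+ x) :* con (+ 1)
                                        := (con (+ 1) :* con (+ 1) :+ x :* con (+ 1)) :* con (+ 1)) refl (+ c)) ⟩
  ℚᵘ.1ℚᵘ ℚᵘ.+ ℚᵘ.mkℚᵘ (+ c) 0      ≈⟨ ℚᵘ.+-congʳ ℚᵘ.1ℚᵘ (ℚ.toℚᵘ-fromℚᵘ (ℚᵘ.mkℚᵘ (+ c) 0)) ⟨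
  toℚᵘ 1ℚ ℚᵘ.+ toℚᵘ (fromℕ c)      ≈⟨ ℚ.toℚᵘ-homo-+ 1ℚ (fromℕ c) ⟨
  toℚᵘ (1ℚ + fromℕ c)              ∎)
  where open ℚᵘ.≃-Reasoning
        open ℤ-Solver

inv*fromℕ : ∀ d → inv (suc d) * fromℕ (suc d) ≡ 1ℚ
inv*fromℕ d = ℚ.toℚᵘ-injective (begin
  toℚᵘ (inv (suc d) * fromℕ (suc d))              ≈⟨ ℚ.toℚᵘ-homo-* (inv (suc d)) (fromℕ (suc d)) ⟩
  toℚᵘ (inv (suc d)) ℚᵘ.* toℚᵘ (fromℕ (suc d))    ≈⟨ ℚᵘ.*-cong (ℚ.toℚᵘ-fromℚᵘ (ℚᵘ.mkℚᵘ (+ 1) d))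
                                                               (ℚ.toℚᵘ-fromℚᵘ (ℚᵘ.mkℚᵘ (+ suc d) 0)) ⟩
  ℚᵘ.mkℚᵘ (+ 1) d ℚᵘ.* ℚᵘ.mkℚᵘ (+ suc d) 0        ≈⟨ ℚᵘ.*≡* (solve 1 (λ x → (con (+ 1) :* x) :* con (+ 1)
                                                       := con (+ 1) :* (x :* con (+ 1))) refl (+ suc d)) ⟩
  ℚᵘ.1ℚᵘ                                          ∎)
  where open ℚᵘ.≃-Reasoning
        open ℤ-Solver

fromℕ-+ : ∀ c d → fromℕ (c ℕ.+ d) ≡ fromℕ c + fromℕ d
fromℕ-+ zero    d = sym (ℚ.+-identityˡ (fromℕ d))
fromℕ-+ (suc c) d = begin
  fromℕ (suc (c ℕ.+ d))       ≡⟨ fromℕ-suc (c ℕ.+ d) ⟩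
  1ℚ + fromℕ (c ℕ.+ d)        ≡⟨ cong (λ r → 1ℚ + r) (fromℕ-+ c d) ⟩
  1ℚ + (fromℕ c + fromℕ d)    ≡⟨ ℚ.+-assoc 1ℚ (fromℕ c) (fromℕ d) ⟨
  1ℚ + fromℕ c + fromℕ d      ≡⟨ cong (_+ fromℕ d) (fromℕ-suc c) ⟨
  fromℕ (suc c) + fromℕ d     ∎
  where open ≡-Reasoning

0≤fromℕ : ∀ c → 0ℚ ℚ.≤ fromℕ c
0≤fromℕ c = ℚ.nonNegative⁻¹ (fromℕ c) {{ℚ.normalize-nonNeg c 1}}

0≤inv : ∀ d → 0ℚ ℚ.≤ inv d
0≤inv zero    = ℚ.≤-refl
0≤inv (suc d) = ℚ.nonNegative⁻¹ (inv (suc d)) {{ℚ.normalize-nonNeg 1 (suc d)}}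

0≤*0≤⇒0≤ : ∀ {p q} → 0ℚ ℚ.≤ p → 0ℚ ℚ.≤ q → 0ℚ ℚ.≤ p * q
0≤*0≤⇒0≤ {p} {q} 0≤p 0≤q = ℚ.nonNegative⁻¹ (p * q)
  {{ℚ.nonNeg*nonNeg⇒nonNeg p {{ℚ.nonNegative 0≤p}} q {{ℚ.nonNegative 0≤q}}}}

0≤p-q⇒q≤p : ∀ {p q} → 0ℚ ℚ.≤ p - q → q ℚ.≤ p
0≤p-q⇒q≤p {p} {q} 0≤p-q = begin
  q             ≡⟨ ℚ.+-identityʳ q ⟨
  q + 0ℚ        ≤⟨ ℚ.+-monoʳ-≤ q 0≤p-q ⟩
  q + (p - q)   ≡⟨ solve 2 (λ p q → q :+ (p :- q) := p) refl p q ⟩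
  p             ∎
  where open ℚ.≤-Reasoning
        open ℚ-Solver

count : ∀ {m} → (Fin m → Bool) → ℕ
count {zero}  P = 0
count {suc m} P = (if P zero then 1 else 0) ℕ.+ count (P ∘ suc)

count-true : ∀ m → count {m} (λ _ → true) ≡ m
count-true zero    = refl
count-true (suc m) = cong suc (count-true m)

count-cong : ∀ {m} {P Q : Fin m → Bool} → (∀ v → P v ≡ Q v) → count P ≡ count Q
count-cong {zero}  P≗Q = refl
count-cong {suc m} P≗Q = cong₂ (λ b c → (if b then 1 else 0) ℕ.+ c) (P≗Q zero) (count-cong (P≗Q ∘ suc))

count-remove : ∀ {m} (P : Fin m → Bool) x → P x ≡ true →
               suc (count (λ v → not (does (v ≟ x)) ∧ P v)) ≡ count P
count-remove {suc m} P zero    Px rewrite Px = refl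
count-remove {suc m} P (suc x) Px =
  trans (sym (ℕ.+-suc P₀ _)) (cong (P₀ ℕ.+_) (count-remove (P ∘ suc) x Px))
  where P₀ = if P zero then 1 else 0

avoids : ∀ {m} → Fin m → List (Fin m) → Bool
avoids v []       = true
avoids v (x ∷ xs) = not (does (v ≟ x)) ∧ avoids v xs

avoids-∈ : ∀ {m} {v : Fin m} {xs} → v ∈ xs → avoids v xs ≡ false
avoids-∈ {v = v}         (here refl)  rewrite dec-true (v ≟ v) refl = refl
avoids-∈ {v = v} {x ∷ _} (there v∈xs) rewrite avoids-∈ v∈xs = ∧-zeroʳ (not (does (v ≟ x)))

avoids-∉ : ∀ {m} {v : Fin m} {xs} → All (v ≢_) xs → avoids v xs ≡ true
avoids-∉                 []                  = refl
avoids-∉ {v = v} (_∷_ {x} v≢x v∉xs) rewrite dec-false (v ≟ x) v≢x = avoids-∉ v∉xs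

avoids-++ : ∀ {m} (v : Fin m) xs ys → avoids v (xs ++ ys) ≡ avoids v xs ∧ avoids v ys
avoids-++ v []       ys = refl
avoids-++ v (x ∷ xs) ys = trans (cong (v∉x ∧_) (avoids-++ v xs ys)) (sym (∧-assoc v∉x (avoids v xs) (avoids v ys)))
  where v∉x = not (does (v ≟ x))

length+count-avoids : ∀ {m} xs → Unique xs → length xs ℕ.+ count {m} (λ v → avoids v xs) ≡ m
length+count-avoids      []       []            = count-true _
length+count-avoids {m} (x ∷ xs) (x∉xs ∷ xs!) = begin
  suc (length xs ℕ.+ count (λ v → avoids v (x ∷ xs)))   ≡⟨ ℕ.+-suc (length xs) _ ⟨
  length xs ℕ.+ suc (count (λ v → avoids v (x ∷ xs)))   ≡⟨ cong (length xs ℕ.+_) (count-remove (λ v → avoids v xs) x (avoids-∉ x∉xs)) ⟩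
  length xs ℕ.+ count (λ v → avoids v xs)               ≡⟨ length+count-avoids xs xs! ⟩
  m                                                     ∎
  where open ≡-Reasoning

Isolated : ∀ {n} → Graph n → Fin n → Set
Isolated g v = ∀ x → ¬ Adj g v x

reach-from-isolated : ∀ {n} {g : Graph n} {v u} → Isolated g v → Reach g v u → u ≡ v
reach-from-isolated isoV here         = refl
reach-from-isolated isoV (step v~x _) = ⊥-elim (isoV _ v~x)

isolated⇒¬connected : ∀ {n} {g : Graph (suc (suc n))} v → Isolated g v → ¬ Connected g
isolated⇒¬connected zero    isoV conn with reach-from-isolated isoV (conn zero (suc zero))
... | ()
isolated⇒¬connected (suc v) isoV conn with reach-from-isolated isoV (conn (suc v) zero)
... | ()

emptyGraph : ∀ {n} → Graph n
emptyGraph _ = false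

emptyGraph-isolated : ∀ {n} (v : Fin n) → Isolated emptyGraph v
emptyGraph-isolated v x (fwd _ ())
emptyGraph-isolated v x (bwd _ ())

endpoints : ∀ {n} → Edge n → List (Fin n)
endpoints ((i , j) , _) = i ∷ j ∷ []

completeExcept : ∀ {n} → Fin n → Graph n
completeExcept v e = avoids v (endpoints e)

completeExcept-isolated : ∀ {n} (v : Fin n) → Isolated (completeExcept v) v
completeExcept-isolated v x (fwd _ v~x) with trans (sym v~x) (avoids-∈ {xs = v ∷ x ∷ []} (here refl))
... | ()
completeExcept-isolated v x (bwd _ x~v) with trans (sym x~v) (avoids-∈ {xs = x ∷ v ∷ []} (there (here refl)))
... | ()

uniform : ∀ {m n} → ℚ → (Fin m → Graph n) → Dist n
uniform w f = tabulate (λ v → w , f v)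

Pr-++ : ∀ {n} (D D′ : Dist n) A → Pr (D ++ D′) A ≡ Pr D A + Pr D′ A
Pr-++ []            D′ A = sym (ℚ.+-identityˡ (Pr D′ A))
Pr-++ ((w , g) ∷ D) D′ A = trans (cong (λ r → wₐ + r) (Pr-++ D D′ A)) (sym (ℚ.+-assoc wₐ (Pr D A) (Pr D′ A)))
  where wₐ = if A g then w else 0ℚ

Pr-uniform : ∀ {m n} w (f : Fin m → Graph n) A → Pr (uniform w f) A ≡ fromℕ (count (A ∘ f)) * w
Pr-uniform {zero}  w f A = sym (ℚ.*-zeroˡ w)
Pr-uniform {suc m} w f A with A (f zero)
... | false = trans (ℚ.+-identityˡ _) (Pr-uniform w (f ∘ suc) A)
... | true  = begin
  w + Pr (uniform w (f ∘ suc)) A    ≡⟨ cong (λ r → w + r) (Pr-uniform w (f ∘ suc) A) ⟩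
  w + fromℕ c * w                   ≡⟨ solve 2 (λ c w → w :+ c :* w := (con 1ℚ :+ c) :* w) refl (fromℕ c) w ⟩
  (1ℚ + fromℕ c) * w                ≡⟨ cong (_* w) (fromℕ-suc c) ⟨
  fromℕ (suc c) * w                 ∎
  where open ≡-Reasoning
        open ℚ-Solver
        c = count (A ∘ f ∘ suc)

rhoPwAtLeast-witness : ∀ {n q} (D : Dist n) → IsDist D → PairwiseIndependent D →
                       (∀ e → q ℚ.≤ Pr D (X e)) → All (λ wg → ¬ Connected (proj₂ wg)) D →
                       RhoPwAtLeast n q
rhoPwAtLeast-witness D isDist pw q≤PrX disconnected p _ _ p<q everyDConnected =
  All¬⇒¬Any (All.map (_∘ proj₂) disconnected)
            (everyDConnected D (isDist , pw , λ e → ℚ.<⇒≤ (ℚ.<-≤-trans p<q (q≤PrX e))))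

-- The difference of the two sides lies in the ideal generated by a (2 + K) − 1 and b (4 + K) − 1.
gap-identity : ∀ K a b → a * (fromℕ 2 + K) ≡ 1ℚ → b * (fromℕ 4 + K) ≡ 1ℚ →
               K * a - (1ℚ - fromℕ 2 * b - fromℕ 8 * b * b) ≡ fromℕ 4 * K * a * b * b
gap-identity K a b a[2+K]≡1 b[4+K]≡1 = begin
  K * a - q                                                     ≡⟨ solve 3 (λ K a b →
      K :* a :- (con 1ℚ :- con (fromℕ 2) :* b :- con (fromℕ 8) :* b :* b)
        := con (fromℕ 4) :* K :* a :* b :* b
           :+ (a :* (con (fromℕ 2) :+ K) :- con 1ℚ) :* (con 1ℚ :- con (fromℕ 2) :* b :- con (fromℕ 8) :* b :* b)
           :+ (b :* (con (fromℕ 4) :+ K) :- con 1ℚ) :* (con (fromℕ 2) :* a :+ con (fromℕ 4) :* a :* b)) refl K a b ⟩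
  r + (a * (fromℕ 2 + K) - 1ℚ) * q + (b * (fromℕ 4 + K) - 1ℚ) * s
                                                                ≡⟨ cong₂ (λ x y → r + (x - 1ℚ) * q + (y - 1ℚ) * s) a[2+K]≡1 b[4+K]≡1 ⟩
  r + (1ℚ - 1ℚ) * q + (1ℚ - 1ℚ) * s                             ≡⟨ solve 3 (λ r q s → r :+ (con 1ℚ :- con 1ℚ) :* q :+ (con 1ℚ :- con 1ℚ) :* s := r) refl r q s ⟩
  r                                                             ∎
  where open ≡-Reasoning
        open ℚ-Solver
        q r s : ℚ
        q = 1ℚ - fromℕ 2 * b - fromℕ 8 * b * b
        r = fromℕ 4 * K * a * b * b
        s = fromℕ 2 * a + fromℕ 4 * a * b

module Construction (k : ℕ) where

  K a b w w∅ : ℚ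
  K  = fromℕ k
  a  = inv (2 ℕ.+ k)
  b  = inv (4 ℕ.+ k)
  w  = K * a * a
  w∅ = fromℕ 4 * a * a

  vertexDeletions : Dist (4 ℕ.+ k)
  vertexDeletions = uniform w completeExcept

  D : Dist (4 ℕ.+ k)
  D = vertexDeletions ++ [ w∅ , emptyGraph ]

  a[2+K]≡1 : a * (fromℕ 2 + K) ≡ 1ℚ
  a[2+K]≡1 = trans (cong (a *_) (sym (fromℕ-+ 2 k))) (inv*fromℕ (1 ℕ.+ k))

  b[4+K]≡1 : b * (fromℕ 4 + K) ≡ 1ℚ
  b[4+K]≡1 = trans (cong (b *_) (sym (fromℕ-+ 4 k))) (inv*fromℕ (3 ℕ.+ k))

  0≤K : 0ℚ ℚ.≤ K
  0≤K = 0≤fromℕ k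

  0≤a : 0ℚ ℚ.≤ a
  0≤a = 0≤inv (2 ℕ.+ k)

  0≤b : 0ℚ ℚ.≤ b
  0≤b = 0≤inv (4 ℕ.+ k)

  Pr-vertexDeletions : ∀ A → Pr vertexDeletions A ≡ fromℕ (count (A ∘ completeExcept)) * w
  Pr-vertexDeletions = Pr-uniform w completeExcept

  Pr-D : ∀ A → A emptyGraph ≡ false → Pr D A ≡ fromℕ (count (A ∘ completeExcept)) * w
  Pr-D A A∅≡false = begin
    Pr D A                                          ≡⟨ Pr-++ vertexDeletions _ A ⟩
    Pr vertexDeletions A + Pr [ w∅ , emptyGraph ] A ≡⟨ cong₂ _+_ (Pr-vertexDeletions A) Pr-∅ ⟩
    fromℕ (count (A ∘ completeExcept)) * w + 0ℚ     ≡⟨ ℚ.+-identityʳ _ ⟩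
    fromℕ (count (A ∘ completeExcept)) * w          ∎
    where open ≡-Reasoning
          Pr-∅ : Pr [ w∅ , emptyGraph ] A ≡ 0ℚ
          Pr-∅ rewrite A∅≡false = ℚ.+-identityˡ 0ℚ

  total : totalWeight D ≡ 1ℚ
  total = begin
    Pr D (λ _ → true)                                    ≡⟨ Pr-++ vertexDeletions [ w∅ , emptyGraph ] (λ _ → true) ⟩
    Pr vertexDeletions (λ _ → true) + (w∅ + 0ℚ)          ≡⟨ cong (_+ (w∅ + 0ℚ)) (Pr-vertexDeletions (λ _ → true)) ⟩
    fromℕ (count {4 ℕ.+ k} (λ _ → true)) * w + (w∅ + 0ℚ) ≡⟨ cong (λ c → fromℕ c * w + (w∅ + 0ℚ)) (count-true (4 ℕ.+ k)) ⟩
    fromℕ (4 ℕ.+ k) * w + (w∅ + 0ℚ)                      ≡⟨ cong (λ c → c * w + (w∅ + 0ℚ)) (fromℕ-+ 4 k) ⟩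
    (fromℕ 4 + K) * (K * a * a) + (fromℕ 4 * a * a + 0ℚ) ≡⟨ solve 2 (λ K a →
        (con (fromℕ 4) :+ K) :* (K :* a :* a) :+ (con (fromℕ 4) :* a :* a :+ con 0ℚ)
          := (a :* (con (fromℕ 2) :+ K)) :* (a :* (con (fromℕ 2) :+ K))) refl K a ⟩
    (a * (fromℕ 2 + K)) * (a * (fromℕ 2 + K))            ≡⟨ cong₂ _*_ a[2+K]≡1 a[2+K]≡1 ⟩
    1ℚ * 1ℚ                                              ≡⟨ ℚ.*-identityˡ 1ℚ ⟩
    1ℚ                                                   ∎
    where open ≡-Reasoning
          open ℚ-Solver

  isDist : IsDist D
  isDist = ++⁺ (tabulate⁺ {f = λ v → w , completeExcept {4 ℕ.+ k} v} (λ _ → 0≤*0≤⇒0≤ (0≤*0≤⇒0≤ 0≤K 0≤a) 0≤a))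
               (0≤*0≤⇒0≤ (0≤*0≤⇒0≤ (0≤fromℕ 4) 0≤a) 0≤a ∷ [])
         , total

  Pr-edge : ∀ e → Pr D (X e) ≡ K * a
  Pr-edge e@((i , j) , i<j) = begin
    Pr D (X e)                                  ≡⟨ Pr-D (X e) refl ⟩
    fromℕ (count (X e ∘ completeExcept)) * w    ≡⟨ cong (λ c → fromℕ c * w) vertices-off-e ⟩
    fromℕ (2 ℕ.+ k) * w                         ≡⟨ cong (_* w) (fromℕ-+ 2 k) ⟩
    (fromℕ 2 + K) * (K * a * a)                 ≡⟨ solve 3 (λ two K a → (two :+ K) :* (K :* a :* a) := (a :* (two :+ K)) :* (K :* a)) refl (fromℕ 2) K a ⟩
    (a * (fromℕ 2 + K)) * (K * a)               ≡⟨ cong (_* (K * a)) a[2+K]≡1 ⟩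
    1ℚ * (K * a)                                ≡⟨ ℚ.*-identityˡ (K * a) ⟩
    K * a                                       ∎
    where open ≡-Reasoning
          open ℚ-Solver
          vertices-off-e : count (X e ∘ completeExcept) ≡ 2 ℕ.+ k
          vertices-off-e = ℕ.+-cancelˡ-≡ 2 _ _ (length+count-avoids (i ∷ j ∷ []) ((<⇒≢ i<j ∷ []) ∷ [] ∷ []))

  Pr-edge-pair : ∀ e f → Disjoint e f → Pr D (λ g → X e g ∧ X f g) ≡ K * a * (K * a)
  Pr-edge-pair e@((i , j) , i<j) f@((i′ , j′) , i′<j′) (i≢i′ , i≢j′ , j≢i′ , j≢j′) = begin
    Pr D (λ g → X e g ∧ X f g)                                                ≡⟨ Pr-D (λ g → X e g ∧ X f g) refl ⟩
    fromℕ (count (λ v → X e (completeExcept v) ∧ X f (completeExcept v))) * w ≡⟨ cong (λ c → fromℕ c * w) vertices-off-e∪f ⟩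
    K * (K * a * a)                                                           ≡⟨ solve 2 (λ K a → K :* (K :* a :* a) := K :* a :* (K :* a)) refl K a ⟩
    K * a * (K * a)                                                           ∎
    where open ≡-Reasoning
          open ℚ-Solver
          vertices-off-e∪f : count (λ v → X e (completeExcept v) ∧ X f (completeExcept v)) ≡ k
          vertices-off-e∪f = trans (count-cong (λ v → sym (avoids-++ v (i ∷ j ∷ []) (i′ ∷ j′ ∷ []))))
            (ℕ.+-cancelˡ-≡ 4 _ _ (length+count-avoids (i ∷ j ∷ i′ ∷ j′ ∷ [])
              ((<⇒≢ i<j ∷ i≢i′ ∷ i≢j′ ∷ []) ∷ (j≢i′ ∷ j≢j′ ∷ []) ∷ (<⇒≢ i′<j′ ∷ []) ∷ [] ∷ [])))

  pairwiseIndependent : PairwiseIndependent D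
  pairwiseIndependent e f e∩f≡∅ = trans (Pr-edge-pair e f e∩f≡∅) (sym (cong₂ _*_ (Pr-edge e) (Pr-edge f)))

  disconnected : All (λ wg → ¬ Connected (proj₂ wg)) D
  disconnected = ++⁺ (tabulate⁺ {f = λ v → w , completeExcept {4 ℕ.+ k} v}
                                (λ v → isolated⇒¬connected v (completeExcept-isolated v)))
                     (isolated⇒¬connected zero (emptyGraph-isolated zero) ∷ [])

  bound≤Pr-edge : ∀ e → 1ℚ - fromℕ 2 * b - fromℕ 8 * b * b ℚ.≤ Pr D (X e)
  bound≤Pr-edge e = begin
    1ℚ - fromℕ 2 * b - fromℕ 8 * b * b    ≤⟨ 0≤p-q⇒q≤p (ℚ.≤-trans 0≤gap (ℚ.≤-reflexive (sym (gap-identity K a b a[2+K]≡1 b[4+K]≡1)))) ⟩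
    K * a                                 ≡⟨ Pr-edge e ⟨
    Pr D (X e)                            ∎
    where open ℚ.≤-Reasoning
          0≤gap : 0ℚ ℚ.≤ fromℕ 4 * K * a * b * b
          0≤gap = 0≤*0≤⇒0≤ (0≤*0≤⇒0≤ (0≤*0≤⇒0≤ (0≤*0≤⇒0≤ (0≤fromℕ 4) 0≤K) 0≤a) 0≤b) 0≤b

  rhoPwAtLeast : RhoPwAtLeast (4 ℕ.+ k) (1ℚ - fromℕ 2 * b - fromℕ 8 * b * b)
  rhoPwAtLeast = rhoPwAtLeast-witness D isDist pairwiseIndependent bound≤Pr-edge disconnected

lemma20 : ∃ λ (C : ℕ) → ∀ (n : ℕ) → 2 ∣ n → 4 ≤ n →
            RhoPwAtLeast n (1ℚ - (+ 2 / 1) * inv n - (+ C / 1) * inv n * inv n)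
lemma20 = 8 , λ { _ _ (s≤s (s≤s (s≤s (s≤s {n = k} z≤n)))) → Construction.rhoPwAtLeast k }
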